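{- Let $T$ be a complete first-order theory with NIP in a countable language, $\bar M$ a saturated (monster) model, $G$ a $\emptyset$-definable measure-stable group, and $M$ any small elementary submodel of $\bar M$. Then: (i) For a definable (with parameters from $\bar M$) set $X\subseteq G$, $X$ is generic in $G$ if and only if $X\cap G(M)$ is left generic in $G(M)$, if and only if $X\cap G(M)$ is right generic in $G(M)$. (ii) The map $p\mapsto p^{\bar M}=\{X\subseteq G \text{ definable}: X\cap G(M)\in p\}$ induces a bijection between the left (resp. right) generic types in $S_{G,ext}(M)$ and the left (resp. right) generic types in $S_G(\bar M)$. (iii) In particular, the left generic and the right generic types in $S_{G,ext}(M)$ coincide, and such types exist.
   Context: NIP: for every formula $\phi(x,y)$, every indiscernible sequence $(a_i)_{i<\omega}$ and every $b$, the truth value of $\phi(a_i,b)$ is eventually constant. $G$ is identified with $G(\bar M)$. $G$ is measure-stable if there are a global type $p\in S_G(\bar M)$ and a countable model $M_0$ such that for every $g\in G$ the type $g\cdot p$ is finitely satisfiable in $M_0$ (every formula in it is realized in $M_0$). A definable $X\subseteq G$ is left generic if finitely many left translates $g\cdot X$ ($g\in G$) cover $G$, similarly right generic; for measure-stable $G$ left and right genericity of definable sets coincide, and "generic" means either. A global type is left/right generic if all its formulas are. An externally definable subset of $G(M)$ is a set $X\cap G(M)$ with $X\subseteq G$ definable with parameters from $\bar M$; these form a Boolean algebra whose Stone space is $S_{G,ext}(M)$. An externally definable $Y\subseteq G(M)$ is left generic in $G(M)$ if finitely many translates $g\cdot Y$ with $g\in G(M)$ cover $G(M)$ (similarly right);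 an external type $p\in S_{G,ext}(M)$ is left/right generic if all its members are. For $p\in S_{G,ext}(M)$, $p^{\bar M}$ is a complete global type finitely satisfiable in $M$. -}

module Defs where

open import Level using (Level; 0ℓ; _⊔_) renaming (suc to lsuc)
open import Algebra.Structures using (IsGroup)
open import Data.Empty using (⊥)
open import Data.Fin using (Fin; zero; suc; _↑ˡ_; _↑ʳ_; splitAt) renaming (_<_ to _<ᶠ_)
open import Data.List using (List)
open import Data.List.Membership.Propositional using () renaming (_∈_ to _∈ᴸ_)
open import Data.List.Relation.Unary.All using () renaming (All to Allᴸ)
open import Data.List.Relation.Unary.Any using () renaming (Any to Anyᴸ)
open import Data.Nat using (ℕ; zero; suc; _+_; _*_; _≤_; _<_)
open import Data.Product using (Σ; ∃; ∃-syntax; _×_; _,_; proj₁; proj₂)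
import Data.Product as Prod
open import Data.Product.Function.NonDependent.Propositional using (_×-⇔_)
open import Data.Sum using (_⊎_; inj₁; inj₂; [_,_]′)
open import Data.Sum.Function.Propositional using (_⊎-⇔_)
open import Data.Vec using (Vec; []; _∷_; _++_; lookup; map; concat; tabulate)
open import Data.Vec.Properties using (lookup-splitAt; lookup-++ˡ; lookup-++ʳ)
open import Data.Vec.Relation.Unary.All using (All)
open import Function using (id; _∘_; _↣_; _⇔_; mk⇔; Equivalence)
open import Function.Definitions using (Injective; Bijective)
open import Function.Properties.Equivalence using () renaming (refl to ⇔-refl; sym to ⇔-sym; trans to ⇔-trans)
open import Relation.Binary using (Rel; _Preserves_⟶_)
open import Relation.Binary.PropositionalEquality using (_≡_; refl; sym; trans; cong; cong₂; subst; subst₂)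
open import Relation.Nullary using (¬_)
open import Relation.Unary using (Pred; U; ∅; ∁; _∩_; _⊆_; _≐_)

record Language : Set₁ where
  field
    FunSym : ℕ → Set
    RelSym : ℕ → Set

CountableLanguage : Language → Set
CountableLanguage L = (∃ FunSym ⊎ ∃ RelSym) ↣ ℕ
  where open Language L

module _ (L : Language) where
  open Language L

  data Term (n : ℕ) : Set where
    var : Fin n → Term n
    fun : ∀ {k} → FunSym k → Vec (Term n) k → Term n

  -- Formulas whose free variables are among n de Bruijn variables.
  data Formula (n : ℕ) : Set where
    _≈̇_ : Term n → Term n → Formula n
    rel : ∀ {k} → RelSym k → Vec (Term n) k → Formula n
    ⊥̇   : Formula n
    _⇒̇_ : Formula n → Formula n → Formula n
    _∧̇_ : Formula n → Formula n → Formula n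
    _∨̇_ : Formula n → Formula n → Formula n
    ∀̇   : Formula (suc n) → Formula n
    ∃̇   : Formula (suc n) → Formula n

  Theory : Set₁
  Theory = Pred (Formula 0) 0ℓ

  record Structure : Set₁ where
    field
      Carrier   : Set
      inhabited : Carrier
      funᴵ      : ∀ {k} → FunSym k → Vec Carrier k → Carrier
      relᴵ      : ∀ {k} → RelSym k → Pred (Vec Carrier k) 0ℓ

module _ {L : Language} where

  ¬̇_ : ∀ {n} → Formula L n → Formula L n
  ¬̇ φ = φ ⇒̇ ⊥̇

  module Semantics (N : Structure L) where
    open Structure N

    eval  : ∀ {n} → Vec Carrier n → Term L n → Carrier
    evals : ∀ {n k} → Vec Carrier n → Vec (Term L n) k → Vec Carrier k
    eval v (var i)    = lookup v i
    eval v (fun f ts) = funᴵ f (evals v ts)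
    evals v []       = []
    evals v (t ∷ ts) = eval v t ∷ evals v ts

    infix 4 _⊩_
    _⊩_ : ∀ {n} → Vec Carrier n → Formula L n → Set
    v ⊩ (s ≈̇ t)  = eval v s ≡ eval v t
    v ⊩ rel R ts = relᴵ R (evals v ts)
    v ⊩ ⊥̇        = ⊥
    v ⊩ (φ ⇒̇ ψ)  = v ⊩ φ → v ⊩ ψ
    v ⊩ (φ ∧̇ ψ)  = (v ⊩ φ) × (v ⊩ ψ)
    v ⊩ (φ ∨̇ ψ)  = (v ⊩ φ) ⊎ (v ⊩ ψ)
    v ⊩ ∀̇ φ      = ∀ x → (x ∷ v) ⊩ φ
    v ⊩ ∃̇ φ      = ∃[ x ] ((x ∷ v) ⊩ φ)

  infix 4 _⊨_[_] _⊨ᵀ_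
  _⊨_[_] : (N : Structure L) → ∀ {n} → Formula L n → Vec (Structure.Carrier N) n → Set
  N ⊨ φ [ v ] = Semantics._⊩_ N v φ

  _⊨ᵀ_ : Structure L → Theory L → Set
  N ⊨ᵀ T = ∀ {σ} → T σ → N ⊨ σ [ [] ]

  Complete : Theory L → Set₁
  Complete T = (∃[ N ] (N ⊨ᵀ T)) × (∀ σ → Entails σ ⊎ Entails (¬̇ σ))
    where
    Entails : Formula L 0 → Set₁
    Entails σ = ∀ N → N ⊨ᵀ T → N ⊨ σ [ [] ]

  liftᴿ : ∀ {m n} → (Fin m → Fin n) → Fin (suc m) → Fin (suc n)
  liftᴿ ρ zero    = zero
  liftᴿ ρ (suc i) = suc (ρ i)

  renameᵗ  : ∀ {m n} → (Fin m → Fin n) → Term L m → Term L n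
  renameᵗˢ : ∀ {m n k} → (Fin m → Fin n) → Vec (Term L m) k → Vec (Term L n) k
  renameᵗ ρ (var i)    = var (ρ i)
  renameᵗ ρ (fun f ts) = fun f (renameᵗˢ ρ ts)
  renameᵗˢ ρ []       = []
  renameᵗˢ ρ (t ∷ ts) = renameᵗ ρ t ∷ renameᵗˢ ρ ts

  rename : ∀ {m n} → (Fin m → Fin n) → Formula L m → Formula L n
  rename ρ (s ≈̇ t)    = renameᵗ ρ s ≈̇ renameᵗ ρ t
  rename ρ (rel R ts) = rel R (renameᵗˢ ρ ts)
  rename ρ ⊥̇          = ⊥̇
  rename ρ (φ ⇒̇ ψ)    = rename ρ φ ⇒̇ rename ρ ψ
  rename ρ (φ ∧̇ ψ)    = rename ρ φ ∧̇ rename ρ ψ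
  rename ρ (φ ∨̇ ψ)    = rename ρ φ ∨̇ rename ρ ψ
  rename ρ (∀̇ φ)      = ∀̇ (rename (liftᴿ ρ) φ)
  rename ρ (∃̇ φ)      = ∃̇ (rename (liftᴿ ρ) φ)

  module Renaming (N : Structure L) where
    open Structure N
    open Semantics N
    open Equivalence

    Agree : ∀ {m n} → (Fin m → Fin n) → Vec Carrier m → Vec Carrier n → Set
    Agree ρ w v = ∀ i → lookup w i ≡ lookup v (ρ i)

    agree-lift : ∀ {m n} {ρ : Fin m → Fin n} {w v} x →
                 Agree ρ w v → Agree (liftᴿ ρ) (x ∷ w) (x ∷ v)
    agree-lift x e zero    = refl
    agree-lift x e (suc i) = e i

    eval-rename : ∀ {m n} {ρ : Fin m → Fin n} {w v} → Agree ρ w v →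
                  ∀ t → eval w t ≡ eval v (renameᵗ ρ t)
    evals-rename : ∀ {m n k} {ρ : Fin m → Fin n} {w v} → Agree ρ w v →
                   (ts : Vec (Term L m) k) → evals w ts ≡ evals v (renameᵗˢ ρ ts)
    eval-rename e (var i)    = e i
    eval-rename e (fun f ts) = cong (funᴵ f) (evals-rename e ts)
    evals-rename e []       = refl
    evals-rename e (t ∷ ts) = cong₂ _∷_ (eval-rename e t) (evals-rename e ts)

    ⊩-rename : ∀ {m n} {ρ : Fin m → Fin n} {w v} → Agree ρ w v →
               ∀ φ → (w ⊩ φ) ⇔ (v ⊩ rename ρ φ)
    ⊩-rename e (s ≈̇ t) = mk⇔
      (subst₂ _≡_ (eval-rename e s) (eval-rename e t))
      (subst₂ _≡_ (sym (eval-rename e s)) (sym (eval-rename e t)))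
    ⊩-rename e (rel R ts) = mk⇔
      (subst (relᴵ R) (evals-rename e ts))
      (subst (relᴵ R) (sym (evals-rename e ts)))
    ⊩-rename e ⊥̇ = ⇔-refl
    ⊩-rename e (φ ⇒̇ ψ) = mk⇔
      (λ h → to (⊩-rename e ψ) ∘ h ∘ from (⊩-rename e φ))
      (λ h → from (⊩-rename e ψ) ∘ h ∘ to (⊩-rename e φ))
    ⊩-rename e (φ ∧̇ ψ) = ⊩-rename e φ ×-⇔ ⊩-rename e ψ
    ⊩-rename e (φ ∨̇ ψ) = ⊩-rename e φ ⊎-⇔ ⊩-rename e ψ
    ⊩-rename e (∀̇ φ) = mk⇔
      (λ h x → to (⊩-rename (agree-lift x e) φ) (h x))
      (λ h x → from (⊩-rename (agree-lift x e) φ) (h x))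
    ⊩-rename e (∃̇ φ) = mk⇔
      (Prod.map₂ (λ {x} → to (⊩-rename (agree-lift x e) φ)))
      (Prod.map₂ (λ {x} → from (⊩-rename (agree-lift x e) φ)))

module _ {L : Language} (𝕄 : Structure L) where
  open Structure 𝕄

  -- A formula φ(x, b) in n variables x with a tuple b of parameters from 𝕄.
  record LFormula (n : ℕ) : Set where
    constructor _⟨_⟩
    field
      {#params} : ℕ
      formula   : Formula L (n + #params)
      params    : Vec Carrier #params

  Holds : ∀ {n} → LFormula n → Pred (Vec Carrier n) 0ℓ
  Holds (φ ⟨ b ⟩) x = 𝕄 ⊨ φ [ x ++ b ]

  IsOver : ∀ {n} → Pred Carrier 0ℓ → Pred (LFormula n) 0ℓ
  IsOver A (φ ⟨ b ⟩) = All A b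

  -- Countable means at most countable.
  Countable : Pred Carrier 0ℓ → Set
  Countable A = Σ (ℕ → Carrier) λ e → ∀ {x} → A x → ∃[ i ] (e i ≡ x)

  FiniteStructure : Set
  FiniteStructure = ∃[ xs ] (∀ (x : Carrier) → x ∈ᴸ xs)

  -- |A| < |𝕄|; as A ⊆ 𝕄, this says that 𝕄 does not inject into A.
  SmallerThan𝕄 : Pred Carrier 0ℓ → Set
  SmallerThan𝕄 A = ¬ (Σ (Carrier → Carrier) λ f → Injective _≡_ _≡_ f × (∀ x → A (f x)))

  -- A finite structure is its own monster model, and there every subset
  -- counts as small.
  Small : Pred Carrier 0ℓ → Set
  Small A = SmallerThan𝕄 A ⊎ FiniteStructure

  record PartialType (n : ℕ) (A : Pred Carrier 0ℓ) : Set₁ where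
    field
      _∋_    : Pred (LFormula n) 0ℓ
      over   : ∀ {ψ} → _∋_ ψ → IsOver A ψ
      finsat : ∀ ψs → Allᴸ _∋_ ψs → ∃[ x ] Allᴸ (λ ψ → Holds ψ x) ψs

  -- For an infinite structure this is saturation in its own cardinality; for
  -- a finite one it holds automatically.
  Saturated : Set₁
  Saturated = ∀ {n} A → Small A → (π : PartialType n A) →
              ∃[ x ] (∀ {ψ} → PartialType._∋_ π ψ → Holds ψ x)

  Monster : Set₁
  Monster = Saturated × (¬ Countable U ⊎ FiniteStructure)

  Indiscernible : ∀ {k} → (ℕ → Vec Carrier k) → Set
  Indiscernible {k} a =
    ∀ {n} (ψ : Formula L (n * k)) (i j : Fin n → ℕ) →
    i Preserves _<ᶠ_ ⟶ _<_ → j Preserves _<ᶠ_ ⟶ _<_ →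
    (𝕄 ⊨ ψ [ concat (tabulate (a ∘ i)) ]) ⇔ (𝕄 ⊨ ψ [ concat (tabulate (a ∘ j)) ])

  NIP : Set
  NIP = ∀ {k l} (φ : Formula L (k + l)) (a : ℕ → Vec Carrier k) → Indiscernible a →
        (b : Vec Carrier l) →
        ∃[ N ] ((∀ i → N ≤ i → 𝕄 ⊨ φ [ a i ++ b ]) ⊎ (∀ i → N ≤ i → ¬ (𝕄 ⊨ φ [ a i ++ b ])))

  -- Elementary submodels are presented by their elementary inclusion maps.
  record ElementarySubmodel : Set₁ where
    field
      model      : Structure L
      incl       : Structure.Carrier model → Carrier
      elementary : ∀ {n} (φ : Formula L n) (a : Vec (Structure.Carrier model) n) →
                   (model ⊨ φ [ a ]) ⇔ (𝕄 ⊨ φ [ map incl a ])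

    universe : Pred Carrier 0ℓ
    universe x = ∃[ a ] (incl a ≡ x)

  -- The group G = G(𝕄) lives on the subset of 𝕄ⁿ defined by γ, and μ defines
  -- the graph of its multiplication.
  record DefinableGroup : Set₁ where
    field
      {dim} : ℕ
      γ     : Formula L dim
      μ     : Formula L (dim + (dim + dim))

    G : Set
    G = ∃[ x ] (𝕄 ⊨ γ [ x ])

    _≈_ : Rel G 0ℓ
    g ≈ h = proj₁ g ≡ proj₁ h

    field
      _∙_     : G → G → G
      ε       : G
      _⁻¹     : G → G
      isGroup : IsGroup _≈_ _∙_ ε _⁻¹
      graph   : ∀ g h k →
                (𝕄 ⊨ μ [ proj₁ g ++ (proj₁ h ++ proj₁ k) ]) ⇔ ((g ∙ h) ≈ k)

-- Ultrafilters of a Boolean algebra B of subsets of A, i.e. points of the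
-- Stone space of B.
record Ultrafilter {A : Set} {ℓ} (B : Pred (Pred A 0ℓ) ℓ) : Set (lsuc 0ℓ ⊔ ℓ) where
  infix 4 _∋_
  field
    _∋_    : Pred (Pred A 0ℓ) 0ℓ
    inB    : ∀ {X} → _∋_ X → B X
    whole  : _∋_ U
    proper : ¬ (_∋_ ∅)
    meet   : ∀ {X Y} → _∋_ X → _∋_ Y → _∋_ (X ∩ Y)
    upward : ∀ {X Y} → _∋_ X → B Y → X ⊆ Y → _∋_ Y
    decide : ∀ {X} → B X → _∋_ X ⊎ _∋_ (∁ X)

open Ultrafilter using (_∋_)

data Side : Set where
  left right : Side

module _ {L : Language} {𝕄 : Structure L} (𝔾 : DefinableGroup 𝕄) where
  open Structure 𝕄
  open DefinableGroup 𝔾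

  act : Side → G → G → G
  act left  g x = g ∙ x
  act right g x = x ∙ g

  -- Used for ι the identity of G and for ι the inclusion of G(M) into G: a
  -- subset of S is regarded as a subset of G along ι.
  module Translation {S : Set} (ι : S → G) where

    Translate : Side → G → Pred S 0ℓ → Pred G 0ℓ
    Translate s g X h = ∃[ x ] (X x × (act s g (ι x) ≈ h))

    -- Finitely many translates of X by elements of S cover S.
    Generic : Side → Pred S 0ℓ → Set
    Generic s X = ∃[ gs ] (∀ h → Anyᴸ (λ g → Translate s (ι g) X (ι h)) gs)

    GenericType : ∀ {ℓ} {B : Pred (Pred S 0ℓ) ℓ} → Side → Ultrafilter B → Set₁
    GenericType s p = ∀ {X} → p ∋ X → Generic s X

  open Translation (id {A = G}) public

  -- Subsets of G definable with parameters from 𝕄.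
  Definable : Pred (Pred G 0ℓ) 0ℓ
  Definable X = ∃[ ψ ] (∀ g → X g ⇔ Holds 𝕄 ψ (proj₁ g))

  -- S_G(𝕄); a type is identified with the ultrafilter of sets its formulas define.
  GlobalType : Set₁
  GlobalType = Ultrafilter Definable

  module Points (M : ElementarySubmodel 𝕄) where
    open ElementarySubmodel M

    -- G(M): the elements of G all of whose coordinates lie in M.
    G⟨M⟩ : Set
    G⟨M⟩ = Σ G λ g → ∃[ a ] (map incl a ≡ proj₁ g)

    inclᴳ : G⟨M⟩ → G
    inclᴳ = proj₁

    -- X ∩ G(M)
    Trace : Pred G 0ℓ → Pred G⟨M⟩ 0ℓ
    Trace X = X ∘ inclᴳ

    ExternallyDefinable : Pred (Pred G⟨M⟩ 0ℓ) (lsuc 0ℓ)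
    ExternallyDefinable Y = ∃[ X ] (Definable X × Y ≐ Trace X)

    -- S_{G,ext}(M)
    ExternalType : Set₁
    ExternalType = Ultrafilter ExternallyDefinable

    FinitelySatisfiable : ∀ {ℓ} → Pred (Pred G 0ℓ) ℓ → Set (lsuc 0ℓ ⊔ ℓ)
    FinitelySatisfiable q = ∀ {X} → q X → ∃[ h ] Trace X h

    open Translation inclᴳ public
      renaming (Translate to Translate⟨M⟩; Generic to Generic⟨M⟩; GenericType to GenericType⟨M⟩)

  -- g · p
  TranslateType : G → GlobalType → Pred (Pred G 0ℓ) (lsuc 0ℓ)
  TranslateType g p Y = ∃[ X ] (p ∋ X × Y ≐ Translate left g X)

  MeasureStable : Set₁
  MeasureStable =
    Σ GlobalType λ p → Σ (ElementarySubmodel 𝕄) λ M₀ →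
    Countable 𝕄 (ElementarySubmodel.universe M₀) ×
    (∀ g → Points.FinitelySatisfiable M₀ (TranslateType g p))

  definable-∩ : ∀ {X Y} → Definable X → Definable Y → Definable (X ∩ Y)
  definable-∩ {X} {Y} (_⟨_⟩ {m₁} φ₁ b₁ , e₁) (_⟨_⟩ {m₂} φ₂ b₂ , e₂) =
    (rename ρ₁ φ₁ ∧̇ rename ρ₂ φ₂) ⟨ b₁ ++ b₂ ⟩ ,
    λ g → ⇔-trans (e₁ g) (⊩-rename (agree₁ (proj₁ g)) φ₁)
          ×-⇔ ⇔-trans (e₂ g) (⊩-rename (agree₂ (proj₁ g)) φ₂)
    where
    open Renaming 𝕄

    ρ₁ : Fin (dim + m₁) → Fin (dim + (m₁ + m₂))
    ρ₁ i = [ _↑ˡ (m₁ + m₂) , (λ j → dim ↑ʳ (j ↑ˡ m₂)) ]′ (splitAt dim i)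

    ρ₂ : Fin (dim + m₂) → Fin (dim + (m₁ + m₂))
    ρ₂ i = [ _↑ˡ (m₁ + m₂) , (λ j → dim ↑ʳ (m₁ ↑ʳ j)) ]′ (splitAt dim i)

    agree₁ : ∀ x → Agree ρ₁ (x ++ b₁) (x ++ (b₁ ++ b₂))
    agree₁ x i with splitAt dim i | lookup-splitAt dim x b₁ i
    ... | inj₁ j | eq = trans eq (sym (lookup-++ˡ x (b₁ ++ b₂) j))
    ... | inj₂ j | eq = trans eq (trans (sym (lookup-++ˡ b₁ b₂ j)) (sym (lookup-++ʳ x (b₁ ++ b₂) (j ↑ˡ m₂))))

    agree₂ : ∀ x → Agree ρ₂ (x ++ b₂) (x ++ (b₁ ++ b₂))
    agree₂ x i with splitAt dim i | lookup-splitAt dim x b₂ i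
    ... | inj₁ j | eq = trans eq (sym (lookup-++ˡ x (b₁ ++ b₂) j))
    ... | inj₂ j | eq = trans eq (trans (sym (lookup-++ʳ b₁ b₂ j)) (sym (lookup-++ʳ x (b₁ ++ b₂) (m₁ ↑ʳ j))))

  definable-U : Definable U
  definable-U = (¬̇ ⊥̇) ⟨ [] ⟩ , λ g → mk⇔ (λ _ → id) (λ _ → _)

  definable-∁ : ∀ {X} → Definable X → Definable (∁ X)
  definable-∁ (φ ⟨ b ⟩ , e) =
    (¬̇ φ) ⟨ b ⟩ , λ g → mk⇔ (λ ¬X → ¬X ∘ Equivalence.from (e g)) (λ ¬φ → ¬φ ∘ Equivalence.to (e g))

  module _ (M : ElementarySubmodel 𝕄) where
    open Points M

    trace-ext : ∀ {X} → Definable X → ExternallyDefinable (Trace X)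
    trace-ext {X} d = X , d , id , id

    -- p ↦ p^𝕄 = { X ⊆ G definable : X ∩ G(M) ∈ p }
    globalize : ExternalType → GlobalType
    globalize p = record
      { _∋_    = λ X → Definable X × p ∋ Trace X
      ; inB    = proj₁
      ; whole  = definable-U , P.whole
      ; proper = λ (_ , h) → P.proper h
      ; meet   = λ (d , h) (d′ , h′) → definable-∩ d d′ , P.meet h h′
      ; upward = λ (_ , h) d X⊆Y → d , P.upward h (trace-ext d) X⊆Y
      ; decide = λ d → [ (λ h → inj₁ (d , h)) , (λ h → inj₂ (definable-∁ d , h)) ]′ (P.decide (trace-ext d))
      }
      where module P = Ultrafilter p

SameType : ∀ {A : Set} {ℓ} {B : Pred (Pred A 0ℓ) ℓ} → Rel (Ultrafilter B) (lsuc 0ℓ)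
SameType p q = ∀ X → (p ∋ X) ⇔ (q ∋ X)

-- f restricts to a bijection, up to SameType, from the types satisfying P onto
-- the types satisfying Q.
InducesBijection : ∀ {A A′ : Set} {ℓ ℓ′} {B : Pred (Pred A 0ℓ) ℓ} {B′ : Pred (Pred A′ 0ℓ) ℓ′} →
                   (Ultrafilter B → Ultrafilter B′) →
                   Pred (Ultrafilter B) (lsuc 0ℓ) → Pred (Ultrafilter B′) (lsuc 0ℓ) →
                   Set (lsuc 0ℓ ⊔ ℓ ⊔ ℓ′)
InducesBijection f P Q =
  Σ (∀ {p} → P p → Q (f p)) λ pres →
  Bijective (λ (p p′ : ∃ P) → SameType (proj₁ p) (proj₁ p′))
            (λ (q q′ : ∃ Q) → SameType (proj₁ q) (proj₁ q′))
            (λ (p , h) → f p , pres h)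

{-# OPTIONS --safe #-}

-- Let p be a global type all of whose left translates are finitely satisfiable
-- in the countable model M₀. If X ∈ p, then every g ∈ G has some m ∈ G(M₀) with
-- g m ∈ X, so by saturation finitely many right translates of X cover G. If
-- finitely many left translates of X cover G, then one of them lies in p; hence
-- left generic sets are right generic, and inversion gives the converse.
--
-- A second use of compactness makes this uniform: if X_b = φ(𝕄, b) is covered by
-- n right translates, then it is covered by the translates by one fixed finite
-- tuple from G(M₀) which does not depend on b. That such a tuple exists is a
-- first-order statement without parameters, so it can be found in any elementary
-- submodel M. Thus a generic X meets G(M), and its trace is generic in G(M).
-- Conversely, if translates by elements of G(M) of the trace of X cover G(M), then
-- one of these translates of X lies in p: otherwise p would contain a set missing
-- G(M). The statements on types follow from those on sets.

module Submission where

open import Defs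
open import Algebra.Bundles using (Group)
import Algebra.Properties.Group as GroupProperties
open import Axiom.ExcludedMiddle using (ExcludedMiddle)
open import Data.Fin using (Fin; zero; suc; _↑ˡ_; _↑ʳ_; combine)
open import Data.List as List using (List; []; _∷_)
import Data.List.Relation.Unary.All as Allᴸ
open import Data.List.Relation.Unary.Any as Anyᴸ using (here; there) renaming (Any to Anyᴸ)
import Data.List.Relation.Unary.Any.Properties as Anyᴸ
open import Data.Nat using (ℕ; zero; suc; _+_; _*_)
open import Data.Product using (Σ; ∃; ∃-syntax; _×_; _,_; proj₁; proj₂)
import Data.Product as Prod
open import Data.Product.Function.NonDependent.Propositional using (_×-⇔_)
open import Data.Sum using (_⊎_; inj₁; inj₂; [_,_]′)
import Data.Sum as Sum
open import Data.Sum.Function.Propositional using (_⊎-⇔_)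
open import Data.Vec using (Vec; []; _∷_; _++_; lookup; map; concat; tabulate; allFin; splitAt)
open import Data.Vec.Properties
open import Data.Vec.Relation.Unary.All as All using (All; []; _∷_)
import Data.Vec.Relation.Unary.All.Properties as All
open import Function using (id; _∘_; _⇔_; mk⇔; Equivalence)
open import Function.Properties.Equivalence using () renaming (refl to ⇔-refl; sym to ⇔-sym; trans to ⇔-trans)
open import Level using (0ℓ; Lift; lift; lower) renaming (suc to lsuc)
import Relation.Binary.Reasoning.Setoid as SetoidReasoning
open import Relation.Binary.PropositionalEquality using (_≡_; refl; sym; trans; cong; cong₂; subst)
open import Relation.Nullary using (¬_; Dec; yes; no; contradiction)
open import Relation.Nullary.Decidable using (True; toWitness; fromWitness; map′; decidable-stable)
open import Relation.Unary using (Pred; U; ∅; ∁; _∩_; _⊆_; _≐_)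
open Equivalence
open Ultrafilter using (_∋_)

lowerEM : ExcludedMiddle (lsuc 0ℓ) → ExcludedMiddle 0ℓ
lowerEM em {P} = map′ lower lift (em {Lift (lsuc 0ℓ) P})

-- Rows of a tuple of length m * n

module _ {A : Set} {m n : ℕ} where

  -- Reading off a list of positions is the shape that `select` produces, so a row of a block of
  -- variables is again a block.
  row : Fin m → Vec A (m * n) → Vec A n
  row i x = map (lookup x) (tabulate (combine i))

  row-concat : (xs : Vec (Vec A n) m) (i : Fin m) → row i (concat xs) ≡ lookup xs i
  row-concat xs i =
    trans (sym (tabulate-∘ (lookup (concat xs)) (combine i)))
          (trans (tabulate-cong (lookup-concat xs i)) (tabulate∘lookup (lookup xs i)))

row-map : ∀ {A B : Set} {m n} (f : A → B) (i : Fin m) (x : Vec A (m * n)) →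
          row i (map f x) ≡ map f (row i x)
row-map f i x = trans (map-cong (λ j → lookup-map j f x) (tabulate (combine i)))
                      (map-∘ f (lookup x) (tabulate (combine i)))

-- Quantifiers over tuples

module _ {L : Language} where

  ∃̇* : ∀ k {n} → Formula L (k + n) → Formula L n
  ∃̇* zero    φ = φ
  ∃̇* (suc k) φ = ∃̇* k (∃̇ φ)

  ∀̇* : ∀ k {n} → Formula L (k + n) → Formula L n
  ∀̇* zero    φ = φ
  ∀̇* (suc k) φ = ∀̇* k (∀̇ φ)

  module _ (N : Structure L) where
    open Structure N using (Carrier)

    ⊨-∃̇* : ∀ k {n} (φ : Formula L (k + n)) {v} →
           (∃[ x ] (N ⊨ φ [ x ++ v ])) ⇔ (N ⊨ ∃̇* k φ [ v ])
    ⊨-∃̇* zero    φ = mk⇔ (λ { ([] , h) → h }) ([] ,_)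
    ⊨-∃̇* (suc k) φ = ⇔-trans
      (mk⇔ (λ { (x ∷ xs , h) → xs , x , h }) (λ (xs , x , h) → x ∷ xs , h))
      (⊨-∃̇* k (∃̇ φ))

    ⊨-∀̇* : ∀ k {n} (φ : Formula L (k + n)) {v} →
           (∀ x → N ⊨ φ [ x ++ v ]) ⇔ (N ⊨ ∀̇* k φ [ v ])
    ⊨-∀̇* zero    φ = mk⇔ (λ h → h []) (λ { h [] → h })
    ⊨-∀̇* (suc k) φ = ⇔-trans
      (mk⇔ (λ h xs x → h (x ∷ xs)) (λ { h (x ∷ xs) → h xs x }))
      (⊨-∀̇* k (∀̇ φ))

-- Relations between tuples definable without parameters

module Definability {L : Language} (N : Structure L) where
  open Structure N
  open Semantics N
  open Renaming N

  -- Environments are nested pairs of tuples. They form a datatype, rather than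
  -- arbitrary maps into tuples, so that unification can invert _⊗_.
  infixr 5 _⊗_
  data Env : Set → ℕ → Set₁ where
    tuple : ∀ {n} → Env (Vec Carrier n) n
    _⊗_   : ∀ {E F m n} → Env E m → Env F n → Env (E × F) (m + n)

  private variable
    E F     : Set
    k m n   : ℕ
    P Q     : Pred E 0ℓ
    env₁    : Env E m
    env₂    : Env F n

  flatten : Env E n → E → Vec Carrier n
  flatten tuple         x       = x
  flatten (env₁ ⊗ env₂) (e , f) = flatten env₁ e ++ flatten env₂ f

  flatten-surjective : (env : Env E n) → ∀ v → ∃[ e ] (flatten env e ≡ v)
  flatten-surjective tuple v = v , refl
  flatten-surjective (_⊗_ {m = m} env₁ env₂) v with splitAt m v
  ... | v₁ , v₂ , refl with flatten-surjective env₁ v₁ | flatten-surjective env₂ v₂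
  ... | e , refl | f , refl = (e , f) , refl

  -- A block only copies coordinates of the environment. Pulling a formula back along it is
  -- therefore a renaming of variables and needs no substitution of terms.
  record Block (env : Env E n) (f : E → Vec Carrier k) : Set where
    constructor block
    field
      positions : Vec (Fin n) k
      reads     : ∀ e → map (lookup (flatten env e)) positions ≡ f e
  open Block

  whole : {env : Env E n} → Block env (flatten env)
  whole {env = env} = block (allFin _) (λ e → map-lookup-allFin (flatten env e))

  fst : {f : E → Vec Carrier k} →
        Block env₁ f → Block (env₁ ⊗ env₂) (λ e → f (proj₁ e))
  fst {env₁ = env₁} {env₂ = env₂} B = block (map (_↑ˡ _) (positions B)) λ (e , f) →
    trans (sym (map-∘ (lookup (flatten env₁ e ++ flatten env₂ f)) (_↑ˡ _) (positions B)))
          (trans (map-cong (lookup-++ˡ (flatten env₁ e) (flatten env₂ f)) (positions B)) (reads B e))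

  snd : {f : F → Vec Carrier k} →
        Block env₂ f → Block (env₁ ⊗ env₂) (λ e → f (proj₂ e))
  snd {env₂ = env₂} {env₁ = env₁} B = block (map (_ ↑ʳ_) (positions B)) λ (e , f) →
    trans (sym (map-∘ (lookup (flatten env₁ e ++ flatten env₂ f)) (_ ↑ʳ_) (positions B)))
          (trans (map-cong (lookup-++ʳ (flatten env₁ e) (flatten env₂ f)) (positions B)) (reads B f))

  infixr 5 _⊕_
  _⊕_ : {env : Env E n} {f : E → Vec Carrier k} {g : E → Vec Carrier m} →
        Block env f → Block env g → Block env (λ e → f e ++ g e)
  _⊕_ {env = env} B C = block (positions B ++ positions C) λ e →
    trans (map-++ (lookup (flatten env e)) (positions B) (positions C)) (cong₂ _++_ (reads B e) (reads C e))

  select : (is : Vec (Fin k) m) {env : Env E n} {f : E → Vec Carrier k} →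
           Block env f → Block env (λ e → map (lookup (f e)) is)
  select is {env} {f} B = block (map (lookup (positions B)) is) λ e →
    trans (sym (map-∘ (lookup (flatten env e)) (lookup (positions B)) is))
          (map-cong (λ i → trans (sym (lookup-map i (lookup (flatten env e)) (positions B)))
                                 (cong (λ v → lookup v i) (reads B e))) is)

  -- Parameters sit in the environment and not in the formula, so one formula serves all their
  -- values. Transfer to submodels and uniformity in parameters both rest on this.
  record Def (env : Env E n) (P : Pred E 0ℓ) : Set where
    constructor def
    field
      formula : Formula L n
      defines : ∀ e → P e ⇔ (flatten env e ⊩ formula)
  open Def

  module _ {env : Env E n} where

    ⊩-def : (φ : Formula L k) {f : E → Vec Carrier k} → Block env f → Def env (λ e → f e ⊩ φ)
    ⊩-def φ B = def (rename (lookup (positions B)) φ) λ e → ⊩-rename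
      (λ i → trans (cong (λ v → lookup v i) (sym (reads B e)))
                   (lookup-map i (lookup (flatten env e)) (positions B))) φ

    ×-def : Def env P → Def env Q → Def env (λ e → P e × Q e)
    ×-def (def φ p) (def ψ q) = def (φ ∧̇ ψ) λ e → p e ×-⇔ q e

    →-def : Def env P → Def env Q → Def env (λ e → P e → Q e)
    →-def (def φ p) (def ψ q) = def (φ ⇒̇ ψ) λ e →
      mk⇔ (λ h → to (q e) ∘ h ∘ from (p e)) (λ h → from (q e) ∘ h ∘ to (p e))

    ∃-def : {P : Vec Carrier k → Pred E 0ℓ} →
            Def (tuple ⊗ env) (λ (x , e) → P x e) → Def env (λ e → ∃[ x ] P x e)
    ∃-def (def φ p) = def (∃̇* _ φ) λ e → ⇔-trans
      (mk⇔ (Prod.map₂ (to (p _))) (Prod.map₂ (from (p _)))) (⊨-∃̇* N _ φ)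

    ∀-def : {P : Vec Carrier k → Pred E 0ℓ} →
            Def (tuple ⊗ env) (λ (x , e) → P x e) → Def env (λ e → ∀ x → P x e)
    ∀-def (def φ p) = def (∀̇* _ φ) λ e → ⇔-trans
      (mk⇔ (λ h x → to (p _) (h x)) (λ h x → from (p _) (h x))) (⊨-∀̇* N _ φ)

    ∃Fin-def : ∀ {l} {P : Fin l → Pred E 0ℓ} →
               (∀ i → Def env (P i)) → Def env (λ e → ∃[ i ] P i e)
    ∃Fin-def {zero}  ds = def ⊥̇ λ e → mk⇔ (λ ()) (λ ())
    ∃Fin-def {suc l} ds with ds zero | ∃Fin-def (ds ∘ suc)
    ... | def φ p | def ψ q = def (φ ∨̇ ψ) λ e → ⇔-trans
      (mk⇔ (λ { (zero , h) → inj₁ h ; (suc i , h) → inj₂ (i , h) })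
           (λ { (inj₁ h) → zero , h ; (inj₂ (i , h)) → suc i , h }))
      (p e ⊎-⇔ q e)

-- Descent of witnesses to elementary submodels

module _ {L : Language} {𝕄 : Structure L} (M : ElementarySubmodel 𝕄) where
  open Structure 𝕄 using (Carrier)
  open ElementarySubmodel M
  open Definability 𝕄

  -- The existential formula is true of `a` in 𝕄, hence in the submodel; a witness found there still
  -- satisfies the formula in 𝕄.
  tarskiVaught : ∀ {k n} {F : Set} {env : Env F n} {P : Pred (Vec Carrier k × F) 0ℓ} →
                 Def (tuple ⊗ env) P → ∀ a {f x} → map incl a ≡ flatten env f → P (x , f) →
                 ∃[ c ] P (map incl c , f)
  tarskiVaught {k} (def φ p) a {f} {x} eq h
    with from (⊨-∃̇* model k φ) (from (elementary (∃̇* k φ) a)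
           (to (⊨-∃̇* 𝕄 k φ) (x , subst (λ v → 𝕄 ⊨ φ [ x ++ v ]) (sym eq) (to (p _) h))))
  ... | c , h′ = c , from (p _) (subst (𝕄 ⊨ φ [_])
    (trans (map-++ incl c a) (cong (map incl c ++_) eq)) (to (elementary φ (c ++ a)) h′))

-- Small sets and compactness

module Smallness (em : ExcludedMiddle (lsuc 0ℓ)) {L : Language} (𝕄 : Structure L) where
  open Structure 𝕄
  open Definability 𝕄

  countable-⊎ : ∀ {A l} → Countable 𝕄 A → (b : Vec Carrier l) →
                Countable 𝕄 (λ x → A x ⊎ ∃[ i ] (lookup b i ≡ x))
  countable-⊎ (e , s) [] = e , λ { (inj₁ a) → s a ; (inj₂ ()) }
  countable-⊎ {A} ctbl (y ∷ b) with countable-⊎ ctbl b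
  ... | e , s = e′ , λ { (inj₁ a) → later (inj₁ a) ; (inj₂ (zero , eq)) → 0 , eq
                       ; (inj₂ (suc i , eq)) → later (inj₂ (i , eq)) }
    where
    e′ : ℕ → Carrier
    e′ zero    = y
    e′ (suc i) = e i
    later : ∀ {x} → A x ⊎ (∃[ i ] (lookup b i ≡ x)) → ∃[ i ] (e′ i ≡ x)
    later a with s a
    ... | i , eq = suc i , eq

  -- If 𝕄 is infinite and injects into A, inverting the injection along the enumeration of A would
  -- enumerate 𝕄.
  countable⇒small : Monster 𝕄 → ∀ {A} → Countable 𝕄 A → Small 𝕄 A
  countable⇒small (_ , inj₂ fin) _ = inj₂ fin
  countable⇒small (_ , inj₁ unc) (e , s) = inj₁ λ (f , inj , inA) →
    let preimage : ℕ → Carrier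
        preimage i = choose (lowerEM em {∃[ x ] (e i ≡ f x)})
    in unc (preimage , λ {x} _ →
         let (i , eq) = s (inA x) in
         i , choose-≡ inj eq (lowerEM em))
    where
    choose : ∀ {P : Pred Carrier 0ℓ} → Dec (∃ P) → Carrier
    choose (yes (x , _)) = x
    -- Indices whose value lies outside the image of `f` get an arbitrary element.
    choose (no _)        = inhabited

    choose-≡ : ∀ {f : Carrier → Carrier} {y x} → (∀ {x x′} → f x ≡ f x′ → x ≡ x′) →
               y ≡ f x → (d : Dec (∃[ x ] (y ≡ f x))) → choose d ≡ x
    choose-≡ inj eq (yes (_ , eq′)) = inj (trans (sym eq′) eq)
    choose-≡ inj eq (no ∄)          = contradiction (_ , eq) ∄

  -- If no finite list of indices suffices, the formulas ¬φ(x, t j) form a finitely satisfiable type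
  -- over A. Saturation realizes it, and the realization is an `e` that no index covers.
  compactness : Saturated 𝕄 → ∀ {A} → Small 𝕄 A →
    ∀ {E F J : Set} {m n} (env₁ : Env E m) (env₂ : Env F n)
    {P : Pred (E × F) 0ℓ} → Def (env₁ ⊗ env₂) P →
    (t : J → F) → (∀ j → All A (flatten env₂ (t j))) →
    (∀ e → ∃[ j ] P (e , t j)) → ∃[ js ] (∀ e → Anyᴸ (λ j → P (e , t j)) js)
  compactness sat {A} small {J = J} env₁ env₂ {P} (def φ p) t over∈A covers =
    decidable-stable (lowerEM em) λ no-cover → absurd (sat A small (type no-cover))
    where
    ψ : J → LFormula 𝕄 _
    ψ j = (¬̇ φ) ⟨ flatten env₂ (t j) ⟩

    indices : ∀ ψs → Allᴸ.All (λ χ → ∃[ j ] (χ ≡ ψ j)) ψs → ∃[ js ] (ψs ≡ List.map ψ js)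
    indices []       Allᴸ.[]                = [] , refl
    indices (_ ∷ ψs) ((j , refl) Allᴸ.∷ hs) with indices ψs hs
    ... | js , refl = j ∷ js , refl

    holds : ∀ e js → ¬ Anyᴸ (λ j → P (e , t j)) js →
            Allᴸ.All (λ χ → Holds 𝕄 χ (flatten env₁ e)) (List.map ψ js)
    holds e []       _ = Allᴸ.[]
    holds e (j ∷ js) h = (h ∘ here ∘ from (p _)) Allᴸ.∷ holds e js (h ∘ there)

    type : ¬ (∃[ js ] (∀ e → Anyᴸ (λ j → P (e , t j)) js)) → PartialType 𝕄 _ A
    type no-cover = record
      { _∋_    = λ χ → ∃[ j ] (χ ≡ ψ j)
      ; over   = λ { (j , refl) → over∈A j }
      ; finsat = finsat
      }
      where
      finsat : ∀ ψs → Allᴸ.All (λ χ → ∃[ j ] (χ ≡ ψ j)) ψs → ∃[ x ] Allᴸ.All (λ χ → Holds 𝕄 χ x) ψs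
      finsat ψs hs with indices ψs hs
      ... | js , refl = decidable-stable (lowerEM em) λ unsat →
        no-cover (js , λ e → decidable-stable (lowerEM em) λ h → unsat (flatten env₁ e , holds e js h))

    absurd : ¬ (∃[ x ] (∀ {χ} → ∃[ j ] (χ ≡ ψ j) → Holds 𝕄 χ x))
    absurd (x , h) with flatten-surjective env₁ x
    ... | e , refl with covers e
    ... | j , pj = h (j , refl) (to (p _) pj)

-- Translates, inverses and covers in a definable group

module DefinableSubsets {L : Language} {𝕄 : Structure L} (𝔾 : DefinableGroup 𝕄) where
  open Structure 𝕄
  open DefinableGroup 𝔾 using (G; dim; γ; μ; isGroup; graph)
  open Definability 𝕄

  group : Group 0ℓ 0ℓ
  group = record { isGroup = isGroup }

  open Group group using
    (setoid; _≈_; _∙_; ε; _⁻¹; ∙-cong; ∙-congˡ; assoc; identityˡ; inverseʳ; ⁻¹-cong)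
  open GroupProperties group using
    (⁻¹-involutive; ⁻¹-anti-homo-∙; identityˡ-unique; inverseʳ-unique;
     \\-leftDividesˡ; \\-leftDividesʳ; //-rightDividesʳ)
  open SetoidReasoning setoid

  -- An element of G carries a proof of `γ`, so equal tuples need not be equal elements; a formula
  -- sees only the tuple.
  respects : ∀ {X} → Definable 𝔾 X → ∀ {g h} → g ≈ h → X g → X h
  respects (ψ , e) {g} {h} eq = from (e h) ∘ subst (Holds 𝕄 ψ) eq ∘ to (e g)

  opposite : Side → Side
  opposite left  = right
  opposite right = left

  act-inverseˡ : ∀ s g x → act 𝔾 s (g ⁻¹) (act 𝔾 s g x) ≈ x
  act-inverseˡ left  g x = \\-leftDividesʳ g x
  act-inverseˡ right g x = //-rightDividesʳ g x

  act-cong : ∀ s {g h x y} → g ≈ h → x ≈ y → act 𝔾 s g x ≈ act 𝔾 s h y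
  act-cong left  {g} {h} {x} {y} p q = ∙-cong {g} {h} {x} {y} p q
  act-cong right {g} {h} {x} {y} p q = ∙-cong {x} {y} {g} {h} q p

  act-⁻¹ : ∀ s g x → (act 𝔾 s g x) ⁻¹ ≈ act 𝔾 (opposite s) (g ⁻¹) (x ⁻¹)
  act-⁻¹ left  g x = ⁻¹-anti-homo-∙ g x
  act-⁻¹ right g x = ⁻¹-anti-homo-∙ x g

  module _ {l} (φ : Formula L (dim + l)) where

    -- Formulas reach multiplication only through its graph, so the product appears as a quantified
    -- tuple `z`. By `productIn-⇔` this is membership of the product once both factors lie in G.
    ProductIn : Vec Carrier dim → Vec Carrier dim → Vec Carrier l → Set
    ProductIn g h b = ∃[ z ] ((𝕄 ⊨ γ [ z ]) × (𝕄 ⊨ μ [ g ++ (h ++ z) ]) × (𝕄 ⊨ φ [ z ++ b ]))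

    productIn-⇔ : ∀ g h b → ProductIn (proj₁ g) (proj₁ h) b ⇔ (𝕄 ⊨ φ [ proj₁ (g ∙ h) ++ b ])
    productIn-⇔ g h b = mk⇔
      (λ (z , γz , μz , φz) → subst (λ x → 𝕄 ⊨ φ [ x ++ b ]) (sym (to (graph g h (z , γz)) μz)) φz)
      (λ φgh → proj₁ (g ∙ h) , proj₂ (g ∙ h) , from (graph g h (g ∙ h)) refl , φgh)

    productIn-def : ∀ {E n} {env : Env E n} {g h b} →
                    Block env g → Block env h → Block env b →
                    Def env (λ e → ProductIn (g e) (h e) (b e))
    productIn-def {env = env} G H B = ∃-def (×-def (⊩-def γ z)
      (×-def (⊩-def μ (snd G ⊕ snd H ⊕ z)) (⊩-def φ (z ⊕ snd B))))
      where
      z : Block (tuple ⊗ env) proj₁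
      z = fst whole

  Holdsᴳ : ∀ {l} → Formula L (dim + l) → Vec Carrier l → Pred G 0ℓ
  Holdsᴳ φ b g = 𝕄 ⊨ φ [ proj₁ g ++ b ]

  definable-Holdsᴳ : ∀ {l} (φ : Formula L (dim + l)) b → Definable 𝔾 (Holdsᴳ φ b)
  definable-Holdsᴳ φ b = φ ⟨ b ⟩ , λ g → ⇔-refl

  def⇒definable : ∀ {F : Set} {l} {env : Env F l} {P : Pred (Vec Carrier dim × F) 0ℓ} {X} →
                  Def (tuple ⊗ env) P → (b : F) → (∀ g → X g ⇔ P (proj₁ g , b)) → Definable 𝔾 X
  def⇒definable {env = env} (def φ p) b e = φ ⟨ flatten env b ⟩ , λ g → ⇔-trans (e g) (p _)

  definable-act : ∀ {X} → Definable 𝔾 X → ∀ s g → Definable 𝔾 (X ∘ act 𝔾 s g)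
  definable-act (φ ⟨ b ⟩ , e) s g = def⇒definable (product s) (proj₁ g , b) λ h →
    ⇔-trans (e (act 𝔾 s g h)) (⇔-sym (product-⇔ s h))
    where
    Factor : Side → Vec Carrier dim → Vec Carrier dim → Vec Carrier _ → Set
    Factor left  g h = ProductIn φ g h
    Factor right g h = ProductIn φ h g

    product : ∀ s → Def (tuple ⊗ (tuple ⊗ tuple)) (λ (h , (g , b)) → Factor s g h b)
    product left  = productIn-def φ (snd (fst whole)) (fst whole) (snd (snd whole))
    product right = productIn-def φ (fst whole) (snd (fst whole)) (snd (snd whole))

    product-⇔ : ∀ s h → Factor s (proj₁ g) (proj₁ h) b ⇔ Holds 𝕄 (φ ⟨ b ⟩) (proj₁ (act 𝔾 s g h))
    product-⇔ left  h = productIn-⇔ φ g h b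
    product-⇔ right h = productIn-⇔ φ h g b

  -- The identity is a parameter `u` instead of being defined inside the formula; for submodels,
  -- `point-ε` shows that it is available there.
  InverseOf : Vec Carrier dim → Vec Carrier dim → Vec Carrier dim → Set
  InverseOf u h z = (𝕄 ⊨ γ [ z ]) × (𝕄 ⊨ μ [ h ++ (z ++ u) ])

  inverseOf-⁻¹ : ∀ h → InverseOf (proj₁ ε) (proj₁ h) (proj₁ (h ⁻¹))
  inverseOf-⁻¹ h = proj₂ (h ⁻¹) , from (graph h (h ⁻¹) ε) (inverseʳ h)

  inverseOf-unique : ∀ h {z} → InverseOf (proj₁ ε) (proj₁ h) z → z ≡ proj₁ (h ⁻¹)
  inverseOf-unique h {z} (γz , μz) = inverseʳ-unique h (z , γz) (to (graph h (z , γz) ε) μz)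

  inverseOf-def : ∀ {E n} {env : Env E n} {u h z} → Block env u → Block env h → Block env z →
                  Def env (λ e → InverseOf (u e) (h e) (z e))
  inverseOf-def U H Z = ×-def (⊩-def γ Z) (⊩-def μ (H ⊕ Z ⊕ U))

  definable-⁻¹ : ∀ {X} → Definable 𝔾 X → Definable 𝔾 (X ∘ _⁻¹)
  definable-⁻¹ (φ ⟨ b ⟩ , e) = def⇒definable inverseIn (proj₁ ε , b) λ h →
    ⇔-trans (e (h ⁻¹)) (mk⇔
      (λ k → proj₁ (h ⁻¹) , inverseOf-⁻¹ h , k)
      (λ (z , inv , k) → subst (λ z → 𝕄 ⊨ φ [ z ++ b ]) (inverseOf-unique h inv) k))
    where
    inverseIn : Def (tuple ⊗ tuple ⊗ tuple)
                    (λ (h , u , b) → ∃[ z ] (InverseOf u h z × (𝕄 ⊨ φ [ z ++ b ])))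
    inverseIn = ∃-def (×-def
      (inverseOf-def (snd (snd (fst whole))) (snd (fst whole)) (fst whole))
      (⊩-def φ (fst whole ⊕ snd (snd (snd whole)))))

  -- S stands for G or for G(M).
  record Subgroup {S : Set} (ι : S → G) : Set where
    field
      mul   : S → S → S
      inv   : S → S
      ι-mul : ∀ g h → ι (mul g h) ≈ ι g ∙ ι h
      ι-inv : ∀ g → ι (inv g) ≈ ι g ⁻¹

  G-subgroup : Subgroup id
  G-subgroup = record { mul = _∙_ ; inv = _⁻¹ ; ι-mul = λ _ _ → refl ; ι-inv = λ _ → refl }

  -- act s g h ∈ X says that h lies in the s-translate of X by g⁻¹.
  Covers : ∀ {S : Set} (ι : S → G) → Side → Pred G 0ℓ → Set
  Covers ι s X = ∃[ gs ] (∀ h → Anyᴸ (λ g → X (act 𝔾 s (ι g) h)) gs)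

  module _ {S : Set} {ι : S → G} (sub : Subgroup ι) {X : Pred G 0ℓ} (dX : Definable 𝔾 X) where
    open Subgroup sub
    open Translation 𝔾 ι using () renaming (Generic to Generic⟨S⟩)

    mul-act : ∀ s (g h : S) → ∃[ x ] (ι x ≈ act 𝔾 s (ι g) (ι h))
    mul-act left  g h = mul g h , ι-mul g h
    mul-act right g h = mul h g , ι-mul h g

    -- A point h lies in the translate of X by g exactly when translating h by the inverse of g
    -- lands in X, so both directions invert the list. Closure of S under products supplies the
    -- point of S that a translate demands.
    generic⟨S⟩⇔ : ∀ s → Generic⟨S⟩ s (X ∘ ι) ⇔
                  (∃[ gs ] (∀ h → Anyᴸ (λ g → X (act 𝔾 s (ι g) (ι h))) gs))
    generic⟨S⟩⇔ s = mk⇔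
      (λ (gs , h) → List.map inv gs , λ x → Anyᴸ.map⁺ (Anyᴸ.map (λ {g} → untranslate g x) (h x)))
      (λ (gs , h) → List.map inv gs , λ x → Anyᴸ.map⁺ (Anyᴸ.map (λ {g} → translate g x) (h x)))
      where
      untranslate : ∀ g h → Translation.Translate 𝔾 ι s (ι g) (X ∘ ι) (ι h) → X (act 𝔾 s (ι (inv g)) (ι h))
      untranslate g h (x , Xx , eq) = respects dX (begin
        ι x                                    ≈⟨ act-inverseˡ s (ι g) (ι x) ⟨
        act 𝔾 s (ι g ⁻¹) (act 𝔾 s (ι g) (ι x)) ≈⟨ act-cong s (sym (ι-inv g)) eq ⟩
        act 𝔾 s (ι (inv g)) (ι h)              ∎) Xx

      translate : ∀ g h → X (act 𝔾 s (ι g) (ι h)) → Translation.Translate 𝔾 ι s (ι (inv g)) (X ∘ ι) (ι h)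
      translate g h Xgh with mul-act s g h
      ... | x , eq = x , respects dX (sym eq) Xgh , (begin
        act 𝔾 s (ι (inv g)) (ι x)               ≈⟨ act-cong s (ι-inv g) eq ⟩
        act 𝔾 s (ι g ⁻¹) (act 𝔾 s (ι g) (ι h)) ≈⟨ act-inverseˡ s (ι g) (ι h) ⟩
        ι h                                     ∎)

    covers⇒generic⟨S⟩ : ∀ s → Covers ι s X → Generic⟨S⟩ s (X ∘ ι)
    covers⇒generic⟨S⟩ s (gs , h) = from (generic⟨S⟩⇔ s) (gs , h ∘ ι)

    -- Inversion reverses products, hence exchanges the two sides and inverts the translating
    -- elements.
    covers-⁻¹ : ∀ s → Covers ι s X → Covers ι (opposite s) (X ∘ _⁻¹)
    covers-⁻¹ s (gs , h) = List.map inv gs , λ x →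
      Anyᴸ.map⁺ (Anyᴸ.map (λ {g} → respects dX (eq s g x)) (h (x ⁻¹)))
      where
      eq : ∀ s g x → act 𝔾 s (ι g) (x ⁻¹) ≈ act 𝔾 (opposite s) (ι (inv g)) x ⁻¹
      eq s g x = sym (begin
        act 𝔾 (opposite s) (ι (inv g)) x ⁻¹                ≈⟨ act-⁻¹ (opposite s) (ι (inv g)) x ⟩
        act 𝔾 (opposite (opposite s)) (ι (inv g) ⁻¹) (x ⁻¹) ≡⟨ cong (λ s → act 𝔾 s (ι (inv g) ⁻¹) (x ⁻¹)) (opp² s) ⟩
        act 𝔾 s (ι (inv g) ⁻¹) (x ⁻¹)                       ≈⟨ act-cong s (⁻¹-cong {ι (inv g)} {ι g ⁻¹} (ι-inv g)) refl ⟩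
        act 𝔾 s (ι g ⁻¹ ⁻¹) (x ⁻¹)                          ≈⟨ act-cong s (⁻¹-involutive (ι g)) refl ⟩
        act 𝔾 s (ι g) (x ⁻¹)                                ∎)
        where
        opp² : ∀ s → opposite (opposite s) ≡ s
        opp² left  = refl
        opp² right = refl

  module _ {X : Pred G 0ℓ} (dX : Definable 𝔾 X) where

    covers-⁻¹⁻¹ : ∀ {S : Set} {ι : S → G} s → Covers ι s (X ∘ _⁻¹ ∘ _⁻¹) → Covers ι s X
    covers-⁻¹⁻¹ s (gs , h) = gs , λ x → Anyᴸ.map (respects dX (⁻¹-involutive _)) (h x)

    generic⇒covers : ∀ s → Generic 𝔾 s X → Covers id s X
    generic⇒covers s = to (generic⟨S⟩⇔ G-subgroup dX s)

    covers⇒generic : ∀ s → Covers id s X → Generic 𝔾 s X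
    covers⇒generic = covers⇒generic⟨S⟩ G-subgroup dX

    -- Left multiplication commutes with right multiplication, so a left translate is handled by
    -- using the cover at `g ⁻¹ ∙ x`; a right translate is absorbed into the list.
    rightCovers-act : ∀ s g → Covers id right (X ∘ act 𝔾 s g) → Covers id right X
    rightCovers-act left  g (ms , h) = ms , λ x → Anyᴸ.map
      (λ {m} → respects dX (begin
        g ∙ (g ⁻¹ ∙ x ∙ m)   ≈⟨ ∙-congˡ {g} (assoc (g ⁻¹) x m) ⟩
        g ∙ (g ⁻¹ ∙ (x ∙ m)) ≈⟨ \\-leftDividesˡ g (x ∙ m) ⟩
        x ∙ m                ∎))
      (h (g ⁻¹ ∙ x))
    rightCovers-act right g (ms , h) = List.map (_∙ g) ms , λ x →
      Anyᴸ.map⁺ (Anyᴸ.map (λ {m} → respects dX (assoc x m g)) (h x))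

  -- G(M) as a subgroup of G

  module ModelPoints (M : ElementarySubmodel 𝕄) where
    open ElementarySubmodel M
    open Points 𝔾 M using (G⟨M⟩; inclᴳ)

    point : ∀ c → 𝕄 ⊨ γ [ map incl c ] → G⟨M⟩
    point c γc = (map incl c , γc) , c , refl

    -- The submodel contains some solution of P with the parameters `a`, and uniqueness identifies
    -- it with `g`.
    definable-point : ∀ {F : Set} {n} {env : Env F n} {P : Pred (Vec Carrier dim × F) 0ℓ} →
      Def (tuple ⊗ env) P → ∀ a f → map incl a ≡ flatten env f →
      ∀ g → P (proj₁ g , f) → (∀ {z} → P (z , f) → z ≡ proj₁ g) → Σ G⟨M⟩ λ x → inclᴳ x ≈ g
    definable-point dP a f eq g Pg unique with tarskiVaught M dP a eq Pg
    ... | c , Pc = (g , c , unique Pc) , refl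

    -- The identity is the only idempotent of a group, which defines it without parameters.
    point-ε : Σ G⟨M⟩ λ x → inclᴳ x ≈ ε
    point-ε = definable-point {env = tuple {0}} {P = λ (z , _) → (𝕄 ⊨ γ [ z ]) × (𝕄 ⊨ μ [ z ++ z ++ z ])}
      (×-def (⊩-def γ (fst whole)) (⊩-def μ (fst whole ⊕ fst whole ⊕ fst whole))) [] [] refl ε
      (proj₂ ε , from (graph ε ε ε) (identityˡ ε))
      (λ {z} (γz , μz) → identityˡ-unique (z , γz) (z , γz) (to (graph (z , γz) (z , γz) (z , γz)) μz))

    point-∙ : ∀ g h → Σ G⟨M⟩ λ x → inclᴳ x ≈ inclᴳ g ∙ inclᴳ h
    point-∙ (g , a , p) (h , b , q) = definable-point
      {env = tuple {dim} ⊗ tuple {dim}} {P = λ (z , g , h) → (𝕄 ⊨ γ [ z ]) × (𝕄 ⊨ μ [ g ++ h ++ z ])}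
      (×-def (⊩-def γ (fst whole)) (⊩-def μ (snd (fst whole) ⊕ snd (snd whole) ⊕ fst whole)))
      (a ++ b) (proj₁ g , proj₁ h) (trans (map-++ incl a b) (cong₂ _++_ p q)) (g ∙ h)
      (proj₂ (g ∙ h) , from (graph g h (g ∙ h)) refl)
      (λ {z} (γz , μz) → sym (to (graph g h (z , γz)) μz))

    point-⁻¹ : ∀ g → Σ G⟨M⟩ λ x → inclᴳ x ≈ inclᴳ g ⁻¹
    point-⁻¹ (g , a , p) = definable-point {env = tuple {dim} ⊗ tuple {dim}} {P = λ (z , u , h) → InverseOf u h z}
      (inverseOf-def (snd (fst whole)) (snd (snd whole)) (fst whole))
      (b ++ a) (proj₁ ε , proj₁ g) (trans (map-++ incl b a) (cong₂ _++_ (trans q (proj₂ point-ε)) p)) (g ⁻¹)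
      (inverseOf-⁻¹ g) (inverseOf-unique g)
      where
      b : Vec (Structure.Carrier model) dim
      b = proj₁ (proj₂ (proj₁ point-ε))
      q : map incl b ≡ proj₁ (inclᴳ (proj₁ point-ε))
      q = proj₂ (proj₂ (proj₁ point-ε))

    G⟨M⟩-subgroup : Subgroup inclᴳ
    G⟨M⟩-subgroup = record
      { mul   = λ g h → proj₁ (point-∙ g h)
      ; inv   = λ g → proj₁ (point-⁻¹ g)
      ; ι-mul = λ g h → proj₂ (point-∙ g h)
      ; ι-inv = λ g → proj₂ (point-⁻¹ g)
      }

  -- Finite covers as a first-order condition on one tuple

  module _ {l} (φ : Formula L (dim + l)) where

    -- x codes a tuple of N points of 𝕄^dim, of which those outside G are ignored.
    RowsCover : ∀ {N} → Vec Carrier (N * dim) → Vec Carrier l → Set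
    RowsCover {N} x b = ∀ g → 𝕄 ⊨ γ [ g ] →
      ∃[ i ] ((𝕄 ⊨ γ [ row {m = N} i x ]) × ProductIn φ g (row {m = N} i x) b)

    rowsCover-def : ∀ {N E n} {env : Env E n} {x b} → Block env x → Block env b →
                    Def env (λ e → RowsCover {N} (x e) (b e))
    rowsCover-def X B = ∀-def (→-def (⊩-def γ (fst whole)) (∃Fin-def λ i →
      ×-def (⊩-def γ (snd (select _ X))) (productIn-def φ (fst whole) (snd (select _ X)) (snd B))))

    rowsOf : (gs : List G) → Vec Carrier (List.length gs * dim)
    rowsOf gs = concat (tabulate (λ i → proj₁ (List.lookup gs i)))

    row-rowsOf : ∀ gs i → row i (rowsOf gs) ≡ proj₁ (List.lookup gs i)
    row-rowsOf gs i = trans (row-concat (tabulate f) i) (lookup∘tabulate f i)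
      where
      f : Fin (List.length gs) → Vec Carrier dim
      f i = proj₁ (List.lookup gs i)

    covers⇒rowsCover : ∀ {b} gs → (∀ h → Anyᴸ (λ g → Holdsᴳ φ b (h ∙ g)) gs) →
                       RowsCover {List.length gs} (rowsOf gs) b
    covers⇒rowsCover {b} gs covers g γg =
      let a = covers (g , γg) ; i = Anyᴸ.index a ; eq = sym (row-rowsOf gs i) in
      i , subst (𝕄 ⊨ γ [_]) eq (proj₂ (List.lookup gs i))
        , subst (λ m → ProductIn φ g m b) eq
            (from (productIn-⇔ φ (g , γg) (List.lookup gs i) b) (Anyᴸ.lookup-index a))

    module _ (em : ExcludedMiddle (lsuc 0ℓ)) where

      rowsCover⇒covers : ∀ {S : Set} {ι : S → G} → S → ∀ {N} x {b} →
        (∀ i → 𝕄 ⊨ γ [ row i x ] → Σ S λ s → proj₁ (ι s) ≡ row i x) →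
        RowsCover {N} x b → Covers ι right (Holdsᴳ φ b)
      rowsCover⇒covers {S} {ι} s₀ {N} x {b} pt h = List.tabulate (λ i → pick i (lowerEM em)) , λ g →
        let (i , γi , k) = h (proj₁ g) (proj₂ g) in
        Anyᴸ.tabulate⁺ i (to (productIn-⇔ φ g _ b) (subst (λ m → ProductIn φ (proj₁ g) m b)
          (sym (pick-≡ i γi (lowerEM em))) k))
        where
        pick : ∀ i → Dec (𝕄 ⊨ γ [ row {m = N} i x ]) → S
        pick i (yes γi) = proj₁ (pt i γi)
        -- Rows outside G get the default `s₀`. This is harmless, since the rows that do the
        -- covering are required to lie in G.
        pick i (no _)   = s₀

        pick-≡ : ∀ i → 𝕄 ⊨ γ [ row {m = N} i x ] → ∀ d → proj₁ (ι (pick i d)) ≡ row i x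
        pick-≡ i _  (yes γi) = proj₂ (pt i γi)
        pick-≡ i γi (no ¬γi) = contradiction γi ¬γi

-- Generic subsets of a measure-stable group

module MeasureStableGroup
  (em : ExcludedMiddle (lsuc 0ℓ)) {L : Language} {𝕄 : Structure L} (monster : Monster 𝕄)
  (𝔾 : DefinableGroup 𝕄) (measureStable : MeasureStable 𝔾) where
  open Structure 𝕄
  open DefinableGroup 𝔾 using (G; dim; γ)
  open Definability 𝕄
  open DefinableSubsets 𝔾
  open Smallness em 𝕄
  open Group group using (setoid; _≈_; _∙_; ε; _⁻¹; assoc; identityʳ; ∙-congˡ)
  open GroupProperties group using (\\-leftDividesˡ)
  open SetoidReasoning setoid

  p : GlobalType 𝔾
  p = proj₁ measureStable

  M₀ : ElementarySubmodel 𝕄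
  M₀ = proj₁ (proj₂ measureStable)

  module p = Ultrafilter p
  open Points 𝔾 M₀ using () renaming (G⟨M⟩ to G⟨M₀⟩; inclᴳ to inclᴳ₀)

  Hits₀ : Pred G 0ℓ → Set
  Hits₀ X = ∀ g → ∃[ m ] X (g ∙ inclᴳ₀ m)

  ∈p⇒hits₀ : ∀ {X} → Definable 𝔾 X → p ∋ X → Hits₀ X
  ∈p⇒hits₀ {X} dX X∈p g =
    -- The type translated by `g ⁻¹` is the one to realize in M₀: a point m of the translate of X by
    -- `g ⁻¹` satisfies g m ∈ X.
    let (m , x , Xx , eq) = proj₂ (proj₂ (proj₂ measureStable)) (g ⁻¹) (X , X∈p , id , id) in
    m , respects dX (begin
      x                ≈⟨ \\-leftDividesˡ g x ⟨
      g ∙ (g ⁻¹ ∙ x)   ≈⟨ ∙-congˡ {g} eq ⟩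
      g ∙ inclᴳ₀ m     ∎) Xx

  universe-map-incl : ∀ {n} (a : Vec (Structure.Carrier (ElementarySubmodel.model M₀)) n) →
                      All (ElementarySubmodel.universe M₀) (map (ElementarySubmodel.incl M₀) a)
  universe-map-incl []      = []
  universe-map-incl (x ∷ a) = (x , refl) ∷ universe-map-incl a

  over-M₀ : ∀ (m : G⟨M₀⟩) → All (ElementarySubmodel.universe M₀) (proj₁ (inclᴳ₀ m))
  over-M₀ (_ , a , eq) = subst (All _) eq (universe-map-incl a)

  ε₀ : G⟨M₀⟩
  ε₀ = proj₁ (ModelPoints.point-ε M₀)

  M₀-countable : Countable 𝕄 (ElementarySubmodel.universe M₀)
  M₀-countable = proj₁ (proj₂ (proj₂ measureStable))

  hits₀⇒rightCovers : ∀ {X} → Definable 𝔾 X → Hits₀ X → Covers id right X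
  hits₀⇒rightCovers {X} (φ ⟨ b ⟩ , e) hits =
    let (ms , covers) = compactness (proj₁ monster)
          (countable⇒small monster (countable-⊎ M₀-countable b))
          tuple (tuple ⊗ tuple)
          -- Compactness ranges over all tuples, so membership in G becomes a hypothesis; tuples
          -- outside G satisfy the implication with any m.
          (→-def (⊩-def γ (fst whole)) (productIn-def φ (fst whole) (snd (fst whole)) (snd (snd whole))))
          (λ m → proj₁ (inclᴳ₀ m) , b) over
          (λ g → hit g (lowerEM em))
    in List.map inclᴳ₀ ms , λ h → Anyᴸ.map⁺ (Anyᴸ.map
         (λ {m} k → from (e _) (to (productIn-⇔ φ h (inclᴳ₀ m) b) (k (proj₂ h)))) (covers (proj₁ h)))
    where
    over : ∀ (m : G⟨M₀⟩) → All (λ x → ElementarySubmodel.universe M₀ x ⊎ ∃[ i ] (lookup b i ≡ x))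
                               (proj₁ (inclᴳ₀ m) ++ b)
    over m = All.++⁺ (All.map inj₁ (over-M₀ m)) (All.lookup⁻ (λ i → inj₂ (i , refl)))

    hit : ∀ g → Dec (𝕄 ⊨ γ [ g ]) → ∃[ m ] (𝕄 ⊨ γ [ g ] → ProductIn φ g (proj₁ (inclᴳ₀ m)) b)
    hit g (yes γg) = Prod.map₂
      (λ {m} Xgm _ → from (productIn-⇔ φ (g , γg) (inclᴳ₀ m) b) (to (e _) Xgm)) (hits (g , γg))
    hit g (no ¬γg) = ε₀ , λ γg → contradiction γg ¬γg

  ∈p⇒rightCovers : ∀ {X} → Definable 𝔾 X → p ∋ X → Covers id right X
  ∈p⇒rightCovers dX X∈p = hits₀⇒rightCovers dX (∈p⇒hits₀ dX X∈p)

  -- If p omits every translate, it contains the intersection `Z` of their complements. `Z` is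
  -- returned because the list may cover all of G or only G(M), and the contradiction differs.
  translates∈p : ∀ {X} → Definable 𝔾 X → ∀ s gs →
    (∃[ g ] (p ∋ (X ∘ act 𝔾 s g))) ⊎
    ∃[ Z ] ((p ∋ Z) × (∀ {h} → Z h → ¬ Anyᴸ (λ g → X (act 𝔾 s g h)) gs))
  translates∈p dX s [] = inj₂ (U , p.whole , λ _ ())
  translates∈p dX s (g ∷ gs) with p.decide (definable-act dX s g) | translates∈p dX s gs
  ... | inj₁ Xg∈p  | _                    = inj₁ (g , Xg∈p)
  ... | inj₂ _     | inj₁ found           = inj₁ found
  ... | inj₂ ∁Xg∈p | inj₂ (Z , Z∈p , Z∩X) = inj₂ (_ , p.meet ∁Xg∈p Z∈p ,
    λ { (¬Xgh , _) (here Xgh) → ¬Xgh Xgh ; (_ , Zh) (there a) → Z∩X Zh a })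

  covers⇒translate∈p : ∀ {X} → Definable 𝔾 X → ∀ s → Covers id s X → ∃[ g ] (p ∋ (X ∘ act 𝔾 s g))
  covers⇒translate∈p dX s (gs , covers) with translates∈p dX s gs
  ... | inj₁ found           = found
  ... | inj₂ (Z , Z∈p , Z∩X) =
    contradiction (p.upward Z∈p definable-∅ (λ {h} Zh → Z∩X Zh (covers h))) p.proper
    where
    definable-∅ : Definable 𝔾 ∅
    definable-∅ = ⊥̇ ⟨ [] ⟩ , λ _ → ⇔-refl

  leftCovers⇒rightCovers : ∀ {X} → Definable 𝔾 X → Covers id left X → Covers id right X
  leftCovers⇒rightCovers dX covers with covers⇒translate∈p dX left covers
  ... | g , Xg∈p = rightCovers-act dX left g (∈p⇒rightCovers (definable-act dX left g) Xg∈p)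

  rightCovers⇒leftCovers : ∀ {X} → Definable 𝔾 X → Covers id right X → Covers id left X
  rightCovers⇒leftCovers dX covers = covers-⁻¹⁻¹ dX left
    (covers-⁻¹ G-subgroup (definable-⁻¹ dX) right
      (leftCovers⇒rightCovers (definable-⁻¹ dX) (covers-⁻¹ G-subgroup dX right covers)))

  covers-any : ∀ {X} → Definable 𝔾 X → ∀ s t → Covers id s X → Covers id t X
  covers-any dX left  left  = id
  covers-any dX left  right = leftCovers⇒rightCovers dX
  covers-any dX right left  = rightCovers⇒leftCovers dX
  covers-any dX right right = id

  -- Some k makes the set of x with k x ∈ X a member of p; hitting that set from `k ⁻¹ ∙ g` amounts
  -- to hitting X from g.
  leftCovers⇒hits₀ : ∀ {X} → Definable 𝔾 X → Covers id left X → Hits₀ X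
  leftCovers⇒hits₀ dX covers g with covers⇒translate∈p dX left covers
  ... | k , Xk∈p = Prod.map₂ (λ {m} → respects dX (begin
      k ∙ (k ⁻¹ ∙ g ∙ inclᴳ₀ m)   ≈⟨ ∙-congˡ {k} (assoc (k ⁻¹) g (inclᴳ₀ m)) ⟩
      k ∙ (k ⁻¹ ∙ (g ∙ inclᴳ₀ m)) ≈⟨ \\-leftDividesˡ k (g ∙ inclᴳ₀ m) ⟩
      g ∙ inclᴳ₀ m                ∎))
    (∈p⇒hits₀ (definable-act dX left k) Xk∈p (k ⁻¹ ∙ g))

  -- Here `b` and `x` are variables of the type and only the points m of M₀ are parameters, so the
  -- finite list given by compactness serves every `b`. Fixing the number n of translates makes
  -- genericity a first-order hypothesis.
  uniformCovers : ∀ {l} (φ : Formula L (dim + l)) n →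
    ∃[ N ] Σ (Vec Carrier (N * dim)) λ y →
    ∀ x b → RowsCover φ {n} x b → RowsCover φ {N} y b
  uniformCovers {l} φ n =
    let (ms , covers) = compactness (proj₁ monster) (countable⇒small monster M₀-countable)
          (tuple ⊗ tuple ⊗ tuple) tuple
          {P = λ ((x , g , b) , m) → RowsCover φ {n} x b → 𝕄 ⊨ γ [ g ] → ProductIn φ g m b}
          (→-def (rowsCover-def φ {n} (fst (fst whole)) (fst (snd (snd whole))))
            (→-def (⊩-def γ (fst (snd (fst whole))))
              (productIn-def φ (fst (snd (fst whole))) (snd whole) (fst (snd (snd whole))))))
          (λ m → proj₁ (inclᴳ₀ m)) over-M₀ (λ (x , g , b) → hit x g b (lowerEM em) (lowerEM em))
    in List.length (List.map inclᴳ₀ ms) , rowsOf φ (List.map inclᴳ₀ ms) , λ x b rc →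
       covers⇒rowsCover φ {b} (List.map inclᴳ₀ ms) λ h → Anyᴸ.map⁺ (Anyᴸ.map
         (λ {m} k → to (productIn-⇔ φ h (inclᴳ₀ m) b) (k rc (proj₂ h))) (covers (x , proj₁ h , b)))
    where
    hit : ∀ x g b → Dec (RowsCover φ {n} x b) → Dec (𝕄 ⊨ γ [ g ]) →
          ∃[ m ] (RowsCover φ {n} x b → 𝕄 ⊨ γ [ g ] → ProductIn φ g (proj₁ (inclᴳ₀ m)) b)
    hit x g b (yes rc) (yes γg) = Prod.map₂
      (λ {m} k _ _ → from (productIn-⇔ φ (g , γg) (inclᴳ₀ m) b) k)
      (leftCovers⇒hits₀ (definable-Holdsᴳ φ b)
        (rightCovers⇒leftCovers (definable-Holdsᴳ φ b)
          (rowsCover⇒covers φ em ε {n} x (λ i γi → (row {m = n} i x , γi) , refl) rc))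
        (g , γg))
    hit x g b (no ¬rc) _        = ε₀ , λ rc → contradiction rc ¬rc
    hit x g b _        (no ¬γg) = ε₀ , λ _ γg → contradiction γg ¬γg

  -- Generic sets and their traces on G(M)

  module _ (M : ElementarySubmodel 𝕄) where
    open ElementarySubmodel M
    open ModelPoints M
    open Points 𝔾 M

    rowsCover-model : ∀ {l} (φ : Formula L (dim + l)) n →
      ∃[ N ] Σ (Vec (Structure.Carrier model) (N * dim)) λ c →
      ∀ x b → RowsCover φ {n} x b → RowsCover φ {N} (map incl c) b
    rowsCover-model {l} φ n =
      let (N , y , uniform) = uniformCovers φ n in N , transfer N y uniform
      where
      transfer : ∀ N y → (∀ x b → RowsCover φ {n} x b → RowsCover φ {N} y b) →
                 Σ (Vec (Structure.Carrier model) (N * dim)) λ c →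
                 ∀ x b → RowsCover φ {n} x b → RowsCover φ {N} (map incl c) b
      transfer N y = tarskiVaught M {env = tuple {0}}
        {P = λ (y , _) → ∀ x b → RowsCover φ {n} x b → RowsCover φ {N} y b}
        (∀-def {P = λ x (y , _) → ∀ b → RowsCover φ {n} x b → RowsCover φ {N} y b}
          (∀-def {P = λ b (x , y , _) → RowsCover φ {n} x b → RowsCover φ {N} y b}
          (→-def (rowsCover-def φ {n} (snd (fst whole)) (fst whole))
                 (rowsCover-def φ {N} (snd (snd (fst whole))) (fst whole)))))
        [] {[]} {y} refl

    -- The parameters `b` of X need not lie in M: the tuple `c` is chosen before them.
    rightCovers-model : ∀ {X} → Definable 𝔾 X → Covers id right X → Covers inclᴳ right X
    rightCovers-model {X} (φ ⟨ b ⟩ , e) (gs , covers) =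
      let (N , c , uniform) = rowsCover-model φ (List.length gs)
          (ms , covers⟨M⟩)  = covers-rows N c (uniform (rowsOf φ gs) b
                                (covers⇒rowsCover φ gs (λ h → Anyᴸ.map (to (e _)) (covers h))))
      in ms , λ h → Anyᴸ.map (from (e _)) (covers⟨M⟩ h)
      where
      covers-rows : ∀ N c → RowsCover φ {N} (map incl c) b → Covers inclᴳ right (Holdsᴳ φ b)
      covers-rows N c = rowsCover⇒covers φ em {ι = inclᴳ} (proj₁ point-ε) {N} (map incl c)
        (λ i γi → point (row {m = N} i c) (subst (𝕄 ⊨ γ [_]) (row-map {m = N} incl i c) γi)
                , sym (row-map {m = N} incl i c))

    rightCovers⇒covers-model : ∀ {X} → Definable 𝔾 X → ∀ s → Covers id right X → Covers inclᴳ s X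
    rightCovers⇒covers-model dX right covers = rightCovers-model dX covers
    -- The left case is the right case for the set of inverses of X.
    rightCovers⇒covers-model dX left  covers = covers-⁻¹⁻¹ dX left
      (covers-⁻¹ G⟨M⟩-subgroup (definable-⁻¹ dX) right
        (rightCovers-model (definable-⁻¹ dX)
          (covers-⁻¹ G-subgroup dX left (rightCovers⇒leftCovers dX covers))))

    rightCovers⇒hits : ∀ {X} → Definable 𝔾 X → Covers id right X → ∃[ h ] Trace X h
    rightCovers⇒hits {X} dX = hit ∘ rightCovers⇒covers-model dX left
      where
      hit : Covers inclᴳ left X → ∃[ h ] Trace X h
      -- A left cover by elements of G(M) covers the identity, so one of these elements itself lies
      -- in X.
      hit (_ , covers) = Prod.map₂ (λ {g} → respects dX (identityʳ (inclᴳ g))) (Anyᴸ.satisfied (covers ε))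

    generic⇒hits : ∀ {X} → Definable 𝔾 X → ∀ s → Generic 𝔾 s X → ∃[ h ] Trace X h
    generic⇒hits dX s = rightCovers⇒hits dX ∘ covers-any dX s right ∘ generic⇒covers dX s

    generic⇒generic⟨M⟩ : ∀ {X} → Definable 𝔾 X → ∀ s t → Generic 𝔾 s X → Generic⟨M⟩ t (Trace X)
    generic⇒generic⟨M⟩ dX s t = covers⇒generic⟨S⟩ G⟨M⟩-subgroup dX t ∘
      rightCovers⇒covers-model dX t ∘ covers-any dX s right ∘ generic⇒covers dX s

    -- If no translate of X lies in p, then p contains a set disjoint from the
    -- finitely many translates covering G(M); but sets in p meet G(M).
    coversG⟨M⟩⇒rightCovers : ∀ {X} → Definable 𝔾 X → ∀ t gs →
      (∀ h → Anyᴸ (λ g → X (act 𝔾 t (inclᴳ g) (inclᴳ h))) gs) → Covers id right X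
    coversG⟨M⟩⇒rightCovers {X} dX t gs covers with translates∈p dX t (List.map inclᴳ gs)
    ... | inj₁ (g , Xg∈p) = rightCovers-act dX t g (∈p⇒rightCovers (definable-act dX t g) Xg∈p)
    ... | inj₂ (Z , Z∈p , Z∩X) =
      contradiction (rightCovers⇒hits (p.inB Z∈p) (∈p⇒rightCovers (p.inB Z∈p) Z∈p)) misses
      where
      misses : ¬ (∃[ h ] Trace Z h)
      misses (h , Zh) = Z∩X Zh (Anyᴸ.map⁺ (covers h))

    generic⟨M⟩⇒generic : ∀ {X} → Definable 𝔾 X → ∀ s t → Generic⟨M⟩ t (Trace X) → Generic 𝔾 s X
    generic⟨M⟩⇒generic dX s t = covers⇒generic dX s ∘ covers-any dX right s ∘
      Prod.uncurry (coversG⟨M⟩⇒rightCovers dX t) ∘ to (generic⟨S⟩⇔ G⟨M⟩-subgroup dX t)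

    generic⟨M⟩-resp-≐ : ∀ s {Y Y′} → Y ≐ Y′ → Generic⟨M⟩ s Y′ → Generic⟨M⟩ s Y
    generic⟨M⟩-resp-≐ s (_ , Y′⊆Y) = Prod.map₂ λ covers h →
      Anyᴸ.map (λ (x , Y′x , eq) → x , Y′⊆Y Y′x , eq) (covers h)

    generic⟨M⟩-sides : ∀ {q : ExternalType} s t → GenericType⟨M⟩ s q → GenericType⟨M⟩ t q
    generic⟨M⟩-sides {q} s t generic Y∈q with Ultrafilter.inB q Y∈q
    ... | X , dX , Y≐X@(Y⊆X , X⊆Y) = generic⟨M⟩-resp-≐ t Y≐X
      (generic⇒generic⟨M⟩ dX left t (generic⟨M⟩⇒generic dX left s
        (generic⟨M⟩-resp-≐ s (X⊆Y , Y⊆X) (generic Y∈q))))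

    -- Generic types and their restriction to G(M)

    module _ (s : Side) (q : GlobalType 𝔾) (generic : GenericType 𝔾 s q) where
      private module q = Ultrafilter q

      -- Otherwise X minus Y would be in q, hence generic, and yet miss G(M). So membership in q
      -- depends only on the trace, which makes `restrict` an ultrafilter.
      trace-upward : ∀ {X Y} → q ∋ X → Definable 𝔾 Y → Trace X ⊆ Trace Y → q ∋ Y
      trace-upward X∈q dY X⊆Y with q.decide dY
      ... | inj₁ Y∈q  = Y∈q
      ... | inj₂ ∁Y∈q = contradiction (generic⇒hits (q.inB X∩∁Y∈q) s (generic X∩∁Y∈q))
                                      (λ (h , Xh , ¬Yh) → ¬Yh (X⊆Y {h} Xh))
        where X∩∁Y∈q = q.meet X∈q ∁Y∈q

      IsTrace : Pred G⟨M⟩ 0ℓ → Set₁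
      IsTrace Y = ∃[ X ] (q ∋ X × Y ≐ Trace X)

      -- Excluded middle resizes IsTrace Y from Set₁ to Set.
      IsTrace₀ : Pred G⟨M⟩ 0ℓ → Set
      IsTrace₀ Y = True (em {IsTrace Y})

      isTrace₀ : ∀ {Y} → IsTrace Y → IsTrace₀ Y
      isTrace₀ = fromWitness

      isTrace : ∀ {Y} → IsTrace₀ Y → IsTrace Y
      isTrace = toWitness

      restrict : ExternalType
      restrict = record
        { _∋_    = IsTrace₀
        ; inB    = λ t → let (X , X∈q , Y≐X) = isTrace t in X , q.inB X∈q , Y≐X
        ; whole  = isTrace₀ (U , q.whole , id , id)
        ; proper = λ t → let (X , X∈q , _ , X⊆∅) = isTrace t
                         in contradiction (generic⇒hits (q.inB X∈q) s (generic X∈q))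
                                          (λ (h , Xh) → X⊆∅ {h} Xh)
        ; meet   = λ t t′ → let (X , X∈q , Y⊆X , X⊆Y) = isTrace t
                                (X′ , X′∈q , Y′⊆X′ , X′⊆Y′) = isTrace t′
                            in isTrace₀ (X ∩ X′ , q.meet X∈q X′∈q ,
                                         Prod.map Y⊆X Y′⊆X′ , Prod.map X⊆Y X′⊆Y′)
        ; upward = λ t (X′ , dX′ , Y′⊆X′ , X′⊆Y′) Y⊆Y′ →
                     let (X , X∈q , Y⊆X , X⊆Y) = isTrace t
                         X′∈q = trace-upward X∈q dX′ (λ {h} Xh → Y′⊆X′ {h} (Y⊆Y′ (X⊆Y {h} Xh)))
                     in isTrace₀ (X′ , X′∈q , Y′⊆X′ , X′⊆Y′)
        ; decide = λ (X , dX , Y⊆X , X⊆Y) → Sum.map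
                     (λ X∈q → isTrace₀ (X , X∈q , Y⊆X , X⊆Y))
                     (λ ∁X∈q → isTrace₀ (∁ X , ∁X∈q , (_∘ X⊆Y) , (_∘ Y⊆X)))
                     (q.decide dX)
        }

      restrict-generic : ∀ t → GenericType⟨M⟩ t restrict
      restrict-generic t Y∈ with isTrace Y∈
      ... | X , X∈q , Y≐X = generic⟨M⟩-resp-≐ t Y≐X (generic⇒generic⟨M⟩ (q.inB X∈q) s t (generic X∈q))

      globalize-restrict : SameType (globalize 𝔾 M restrict) q
      globalize-restrict X = mk⇔
        (λ (dX , X∈) → let (_ , X′∈q , _ , X′⊆X) = isTrace X∈ in trace-upward X′∈q dX (λ {h} → X′⊆X {h}))
        (λ X∈q → q.inB X∈q , isTrace₀ (X , X∈q , id , id))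

    globalize-injective : ∀ {q q′ : ExternalType} → SameType (globalize 𝔾 M q) (globalize 𝔾 M q′) →
                          ∀ {Y} → q ∋ Y → q′ ∋ Y
    globalize-injective {q} {q′} same {Y} Y∈q with Ultrafilter.inB q Y∈q
    ... | X , dX , Y⊆X , X⊆Y = Ultrafilter.upward q′
      (proj₂ (to (same X) (dX , Ultrafilter.upward q Y∈q (trace-ext 𝔾 M dX) Y⊆X)))
      (X , dX , Y⊆X , X⊆Y) X⊆Y

    globalize-bijection : ∀ s → InducesBijection (globalize 𝔾 M) (GenericType⟨M⟩ s) (GenericType 𝔾 s)
    globalize-bijection s =
      (λ generic (dX , X∈q) → generic⟨M⟩⇒generic dX s s (generic X∈q)) ,
      (λ {(q , _)} {(q′ , _)} same Y → mk⇔ (globalize-injective {q} {q′} same)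
                                           (globalize-injective {q′} {q} (λ X → ⇔-sym (same X)))) ,
      -- Surjectivity is asked of every type with the same members as the chosen preimage, hence the
      -- extra argument `same`.
      (λ (q , generic) → (restrict s q generic , restrict-generic s q generic s) , λ same X →
        ⇔-trans (mk⇔ (Prod.map₂ (to (same _))) (Prod.map₂ (from (same _)))) (globalize-restrict s q generic X))

    p-generic : GenericType 𝔾 right p
    p-generic X∈p = covers⇒generic (p.inB X∈p) right (∈p⇒rightCovers (p.inB X∈p) X∈p)

theorem3p4 : ExcludedMiddle (lsuc 0ℓ) →
    (L : Language) → CountableLanguage L →
    (T : Theory L) → Complete T →
    (𝕄 : Structure L) → 𝕄 ⊨ᵀ T → Monster 𝕄 → NIP 𝕄 →
    (𝔾 : DefinableGroup 𝕄) → MeasureStable 𝔾 →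
    (M : ElementarySubmodel 𝕄) → Small 𝕄 (ElementarySubmodel.universe M) →
    let open Points 𝔾 M in
    (∀ X → Definable 𝔾 X → ∀ s t → Generic 𝔾 s X ⇔ Generic⟨M⟩ t (Trace X))
    × (∀ s → InducesBijection (globalize 𝔾 M) (GenericType⟨M⟩ s) (GenericType 𝔾 s))
    × ((∀ (p : ExternalType) → GenericType⟨M⟩ left p ⇔ GenericType⟨M⟩ right p)
    × Σ ExternalType (λ p → GenericType⟨M⟩ left p × GenericType⟨M⟩ right p))
theorem3p4 em L _ T _ 𝕄 _ monster _ 𝔾 measureStable M _ =
  (λ X dX s t → mk⇔ (generic⇒generic⟨M⟩ M dX s t) (generic⟨M⟩⇒generic M dX s t)) ,
  globalize-bijection M ,
  (λ q → mk⇔ (generic⟨M⟩-sides M {q} left right) (generic⟨M⟩-sides M {q} right left)) ,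
  -- The type witnessing measure stability is right generic, so its restriction shows existence.
  restrict M right p (p-generic M) ,
  restrict-generic M right p (p-generic M) left ,
  restrict-generic M right p (p-generic M) right
  where open MeasureStableGroup em monster 𝔾 measureStable
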